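{- Let $m\in\mathbb{N}$ and let $\lambda$ be a nonzero real number. For all integers $n,l\ge0$, \[ D_{m,\lambda}(n+l,x)=\sum_{j=0}^{l}\sum_{k=0}^{n}\binom{n}{k}W_{m,\lambda}(l,j)\,x^{j}\,(mj-l\lambda)_{n-k,\lambda}\,D_{m,\lambda}(k,x) \] as polynomials in $x$; equivalently, with $a^{+}$ the boson creation operator, \[ D_{m,\lambda}(n+l,m a^{+})=\sum_{j=0}^{l}\sum_{k=0}^{n}\binom{n}{k}W_{m,\lambda}(l,j)\,m^{j}(a^{+})^{j}(mj-l\lambda)_{n-k,\lambda}D_{m,\lambda}(k,m a^{+}). \]
   Context: $(x)_{0,\lambda}=1$ and $(x)_{n,\lambda}=x(x-\lambda)\cdots(x-(n-1)\lambda)$ for $n\ge1$; $(x)_k=x(x-1)\cdots(x-k+1)$. For $m\in\mathbb{N}$, the degenerate Whitney numbers of the second kind $W_{m,\lambda}(n,k)$ are defined by $(mx+1)_{n,\lambda}=\sum_{k=0}^{n}W_{m,\lambda}(n,k)m^{k}(x)_k$ ($n\ge0$), and the degenerate Dowling polynomials are $D_{m,\lambda}(n,x)=\sum_{k=0}^{n}W_{m,\lambda}(n,k)x^{k}$. -}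

module Defs where

open import Level using (Level; _⊔_; suc)
open import Algebra.Bundles using (CommutativeRing; Ring)
open import Algebra.Bundles.Raw using (RawRing)
open import Algebra.Apartness.Bundles using (HeytingField; HeytingCommutativeRing)
open import Algebra.Morphism.Structures using (module RingMorphisms)
import Algebra.Definitions.RawSemiring as RawSemiringDefs
open import Data.Fin.Base using (toℕ)
open import Data.List.Base using (List; []; _∷_; map)
open import Data.Nat.Base using (ℕ; NonZero)

-- The operations are given over raw rings so that the same definitions serve
-- for scalars, for polynomials and for (noncommutative) operator algebras.

module RingNotation {c ℓ} (R : RawRing c ℓ) where

  open RawRing R
  open RawSemiringDefs rawSemiring public using (_×_; _^_; sum)

  -- Both endpoints 0 and n are included.
  Σ≤ : ℕ → (ℕ → Carrier) → Carrier
  Σ≤ n f = sum {ℕ.suc n} (λ k → f (toℕ k))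

  infix 5 Σ≤
  syntax Σ≤ n (λ k → e) = Σ[ k ≤ n ] e

  -- The degeneracy parameter λ is written μ, λ being a keyword.
  -- (x)_{n,μ} = x (x - μ) ⋯ (x - (n-1) μ)
  degFalling : Carrier → ℕ → Carrier → Carrier
  degFalling x ℕ.zero    μ = 1#
  degFalling x (ℕ.suc n) μ = degFalling x n μ * (x + (- (n × μ)))

  -- (x)_n = x (x - 1) ⋯ (x - n + 1)
  falling : Carrier → ℕ → Carrier
  falling x n = degFalling x n 1#

-- Polynomials in one variable as coefficient lists, constant term first.
-- Trailing zeros are allowed; equality compares all coefficients.

module Polynomial {c ℓ} (R : RawRing c ℓ) where

  open RawRing R

  Poly : Set c
  Poly = List Carrier

  coeff : Poly → ℕ → Carrier
  coeff []      _         = 0#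
  coeff (a ∷ p) ℕ.zero    = a
  coeff (a ∷ p) (ℕ.suc i) = coeff p i

  infix 4 _≈ₚ_
  _≈ₚ_ : Poly → Poly → Set ℓ
  p ≈ₚ q = ∀ i → coeff p i ≈ coeff q i

  infixl 6 _+ₚ_
  _+ₚ_ : Poly → Poly → Poly
  []      +ₚ q       = q
  (a ∷ p) +ₚ []      = a ∷ p
  (a ∷ p) +ₚ (b ∷ q) = (a + b) ∷ (p +ₚ q)

  infixl 7 _*ₚ_
  _*ₚ_ : Poly → Poly → Poly
  []      *ₚ q = []
  (a ∷ p) *ₚ q = map (a *_) q +ₚ (0# ∷ (p *ₚ q))

  const : Carrier → Poly
  const a = a ∷ []

  X : Poly
  X = 0# ∷ 1# ∷ []

  polyRawRing : RawRing c ℓ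
  polyRawRing = record
    { Carrier = Poly
    ; _≈_     = _≈ₚ_
    ; _+_     = _+ₚ_
    ; _*_     = _*ₚ_
    ; -_      = map -_
    ; 0#      = []
    ; 1#      = const 1#
    }

-- An associative unital algebra over R with an annihilation operator a and a
-- creation operator a⁺ obeying the canonical commutation relation.
-- R acts through a ring homomorphism ι into the centre. The operators on Fock
-- space generated by a and a⁺ are an instance.

record BosonAlgebra {c ℓ} (R : CommutativeRing c ℓ) (b ℓb : Level)
    : Set (c ⊔ ℓ ⊔ suc (b ⊔ ℓb)) where
  private module R = CommutativeRing R
  field
    ring : Ring b ℓb
  open Ring ring public
  open RingMorphisms R.rawRing rawRing using (IsRingHomomorphism)
  field
    ι                  : R.Carrier → Carrier
    ι-isRingHomomorphism : IsRingHomomorphism ι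
    ι-central          : ∀ r y → ι r * y ≈ y * ι r
    a                  : Carrier
    a⁺                 : Carrier
    commutation        : a * a⁺ - a⁺ * a ≈ 1#

  open Polynomial R.rawRing using (Poly)

  eval : Poly → Carrier → Carrier
  eval []      y = 0#
  eval (r ∷ p) y = ι r + y * eval p y

module Whitney {c ℓ} (R : RawRing c ℓ) where

  open RawRing R
  open RingNotation R using (_×_; _^_)
  open Polynomial R
  private
    module P  = RawRing polyRawRing
    module PN = RingNotation polyRawRing
  open PN using (Σ≤)

  -- (mX + 1)_{n,μ} = Σ_{k ≤ n} W(n,k) m^k (X)_k as polynomials in X, for all n.
  -- Values W n k with k > n are left unconstrained; they are never used.
  IsWhitney : ℕ → Carrier → (ℕ → ℕ → Carrier) → Set ℓ
  IsWhitney m μ W = ∀ n →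
    PN.degFalling ((m PN.× X) P.+ P.1#) n (const μ)
      P.≈ (Σ[ k ≤ n ] (const (W n k * (m × 1#) ^ k) P.* PN.falling X k))

  -- D(n,X) = Σ_{k ≤ n} W(n,k) X^k
  dowling : (ℕ → ℕ → Carrier) → ℕ → Poly
  dowling W n = Σ[ k ≤ n ] (const (W n k) P.* (X PN.^ k))

module _ {c ℓ₁ ℓ₂} (F : HeytingField c ℓ₁ ℓ₂) where

  open HeytingField F

  fieldRing : CommutativeRing c ℓ₁
  fieldRing = HeytingCommutativeRing.commutativeRing heytingCommutativeRing

  open RingNotation (CommutativeRing.rawRing fieldRing) using (_×_)

  -- Apartness from 0# is the constructive "nonzero"; classically it is x ≉ 0#.
  CharacteristicZero : Set ℓ₂
  CharacteristicZero = ∀ n → .{{NonZero n}} → (n × 1#) # 0#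

-- The two forms of the identity, for given values W of the Whitney numbers.

module Identities {c ℓ} (R : CommutativeRing c ℓ) where

  open CommutativeRing R
  open import Data.Nat.Base as ℕ using (_∸_)
  open import Data.Nat.Combinatorics using (_C_)
  open RingNotation rawRing using (_×_; degFalling)
  open Polynomial rawRing
  open Whitney rawRing

  module _ (m : ℕ) (μ : Carrier) (W : ℕ → ℕ → Carrier) (n l : ℕ) where

    PolynomialIdentity : Set ℓ
    PolynomialIdentity =
      dowling W (n ℕ.+ l) P.≈
        (Σ[ j ≤ l ] Σ[ k ≤ n ]
          ((n C k) PN.×
            (const (W l j) P.* (X PN.^ j)
              P.* const (degFalling (((m ℕ.* j) × 1#) - (l × μ)) (n ∸ k) μ)
              P.* dowling W k)))
      where
      module P  = RawRing polyRawRing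
      module PN = RingNotation polyRawRing
      open PN using (Σ≤)

    OperatorIdentity : ∀ {b ℓb} → BosonAlgebra R b ℓb → Set ℓb
    OperatorIdentity A =
      A.eval (dowling W (n ℕ.+ l)) (m AN.× A.a⁺) A.≈
        (Σ[ j ≤ l ] Σ[ k ≤ n ]
          ((n C k) AN.×
            (A.ι (W l j) A.* ((m AN.× A.1#) AN.^ j) A.* (A.a⁺ AN.^ j)
              A.* A.ι (degFalling (((m ℕ.* j) × 1#) - (l × μ)) (n ∸ k) μ)
              A.* A.eval (dowling W k) (m AN.× A.a⁺))))
      where
      module A  = BosonAlgebra A
      module AN = RingNotation A.rawRing
      open AN using (Σ≤)

{-# OPTIONS --safe #-}
-- Put U = m⁻¹ a⁺ + a⁺ a and T = m U + 1 and let P be the projection onto the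
-- vacuum, so that a P = 0.  From U a⁺ = a⁺ (U + 1) one gets m^k (U)_k P = (a⁺)^k P,
-- hence evaluating the defining identity of the Whitney numbers at X = U gives
-- D(n, a⁺) P = (T)_n P.  Now (T)_{l+n} = (T - lμ)_n (T)_l, moving (T - lμ)_n past
-- (a⁺)^j turns it into (T + mj - lμ)_n, and the Vandermonde convolution expands the
-- latter in the (T)_k.  On the Fock space of sequences, p(a⁺) P determines the
-- coefficients of p, which gives the polynomial identity; evaluating that at m a⁺
-- gives the operator identity.
module Submission where

open import Defs
open import Level using (Level; _⊔_)
open import Algebra.Apartness.Bundles using (HeytingField)
open import Algebra.Bundles using (CommutativeRing; Ring)
open import Algebra.Bundles.Raw using (RawRing)
open import Algebra.Morphism.Structures using (module RingMorphisms)
import Algebra.Properties.CommutativeMonoid.Mult as CommutativeMonoidMult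
import Algebra.Properties.CommutativeSemigroup as CommutativeSemigroupProperties
import Algebra.Properties.Ring as RingProperties
import Algebra.Properties.Semiring.Mult as SemiringMult
import Algebra.Properties.Semiring.Sum as SemiringSum
open import Data.Fin.Base using (Fin; toℕ; zero; suc)
open import Data.Fin.Properties using (toℕ≤pred[n])
open import Data.List.Base using ([]; _∷_; map)
open import Data.Nat.Base as ℕ using (ℕ; NonZero; zero; suc; _∸_)
open import Data.Nat.Combinatorics
  using (_C_; nCk+nC[k+1]≡[n+1]C[k+1]; k>n⇒nCk≡0)
import Data.Nat.Properties as ℕ
open import Data.Product.Base using (_,_; proj₁; proj₂)
open import Function.Base using (_∘_)
import Relation.Binary.PropositionalEquality as ≡
import Relation.Binary.Reasoning.Setoid as SetoidReasoning

-- Homomorphisms out of a raw ring, such as the polynomials as coefficient lists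

module HomomorphismProperties
  {c ℓ c′ ℓ′} (R : RawRing c ℓ) (S : Ring c′ ℓ′)
  {f : RawRing.Carrier R → Ring.Carrier S}
  (f-isHom : RingMorphisms.IsRingHomomorphism R (Ring.rawRing S) f) where

  open Ring S
  open RingMorphisms.IsRingHomomorphism f-isHom
  private
    module R  = RawRing R
    module RN = RingNotation R
    module SN = RingNotation rawRing

  ×-homo : ∀ n x → f (n RN.× x) ≈ n SN.× f x
  ×-homo zero    x = 0#-homo
  ×-homo (suc n) x = trans (+-homo x _) (+-congˡ (×-homo n x))

  ^-homo : ∀ x n → f (x RN.^ n) ≈ f x SN.^ n
  ^-homo x zero    = 1#-homo
  ^-homo x (suc n) = trans (*-homo x _) (*-congˡ (^-homo x n))

  sum-homo : ∀ {n} (t : Fin n → R.Carrier) → f (RN.sum t) ≈ SN.sum (f ∘ t)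
  sum-homo {zero}  t = 0#-homo
  sum-homo {suc n} t = trans (+-homo _ _) (+-congˡ (sum-homo (t ∘ suc)))

  Σ≤-homo : ∀ n t → f (RN.Σ≤ n t) ≈ SN.Σ≤ n (f ∘ t)
  Σ≤-homo n t = sum-homo {suc n} (t ∘ toℕ)

  degFalling-homo : ∀ x n μ → f (RN.degFalling x n μ) ≈ SN.degFalling (f x) n (f μ)
  degFalling-homo x zero    μ = 1#-homo
  degFalling-homo x (suc n) μ = trans (*-homo _ _)
    (*-cong (degFalling-homo x n μ)
      (trans (+-homo _ _) (+-congˡ (trans (-‿homo _) (-‿cong (×-homo n μ))))))

-- Finite sums in a noncommutative ring

module RingLemmas {c ℓ} (S : Ring c ℓ) where

  open Ring S renaming (Carrier to A)
  open RingNotation rawRing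
  open RingProperties S using (-‿distribˡ-*; -‿distribʳ-*; -‿+-comm)
  open SemiringMult semiring
    using (×-congʳ; ×-congˡ; ×-homo-+; ×-comm-*; ×-assoc-*)
  open CommutativeMonoidMult +-commutativeMonoid using (×-distrib-+)
  open CommutativeSemigroupProperties +-commutativeSemigroup using (interchange; x∙yz≈y∙xz)
  open SemiringSum semiring
    using (sum-cong-≋; ∑-distrib-+; *-distribˡ-sum; *-distribʳ-sum)
  open SetoidReasoning setoid

  Σ≤-cong : ∀ n {f g : ℕ → A} → (∀ k → k ℕ.≤ n → f k ≈ g k) → Σ≤ n f ≈ Σ≤ n g
  Σ≤-cong n f≈g = sum-cong-≋ {suc n} (λ k → f≈g (toℕ k) (toℕ≤pred[n] k))

  Σ≤-+ : ∀ n (f g : ℕ → A) → Σ≤ n (λ k → f k + g k) ≈ Σ≤ n f + Σ≤ n g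
  Σ≤-+ n f g = ∑-distrib-+ {suc n} (f ∘ toℕ) (g ∘ toℕ)

  *-distribˡ-Σ≤ : ∀ n x (f : ℕ → A) → x * Σ≤ n f ≈ Σ≤ n (λ k → x * f k)
  *-distribˡ-Σ≤ n x f = *-distribˡ-sum {suc n} x (f ∘ toℕ)

  *-distribʳ-Σ≤ : ∀ n x (f : ℕ → A) → Σ≤ n f * x ≈ Σ≤ n (λ k → f k * x)
  *-distribʳ-Σ≤ n x f = *-distribʳ-sum {suc n} x (f ∘ toℕ)

  Σ≤-last : ∀ n (f : ℕ → A) → Σ≤ (suc n) f ≈ Σ≤ n f + f (suc n)
  Σ≤-last zero    f = trans (+-congˡ (+-identityʳ _)) (+-congʳ (sym (+-identityʳ _)))
  Σ≤-last (suc n) f = trans (+-congˡ (Σ≤-last n (f ∘ suc))) (sym (+-assoc _ _ _))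

  -- Pascal's rule splits each coefficient of row `suc n` in two, and reindexing one half collects
  -- both contributions of row `n` at the same `k`. This is the induction step of a binomial
  -- expansion whose terms depend on two exponents, either of which may be raised by one.
  Σ≤-pascal : ∀ n (g : ℕ → ℕ → A) →
    Σ≤ (suc n) (λ k → (suc n C k) × g (suc n ∸ k) k) ≈
    Σ≤ n (λ k → (n C k) × (g (n ∸ k) (suc k) + g (suc (n ∸ k)) k))
  Σ≤-pascal n g = begin
    g (suc n) 0 + 0# + Σ≤ n (λ k → (suc n C suc k) × g (n ∸ k) (suc k))
      ≈⟨ +-congˡ (Σ≤-cong n (λ k _ → trans
           (×-congˡ (≡.sym (nCk+nC[k+1]≡[n+1]C[k+1] n k)))
           (×-homo-+ (g (n ∸ k) (suc k)) (n C k) (n C suc k)))) ⟩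
    g (suc n) 0 + 0# + Σ≤ n (λ k → up k + (n C suc k) × g (n ∸ k) (suc k))
      ≈⟨ +-congˡ (Σ≤-+ n up (λ k → (n C suc k) × g (n ∸ k) (suc k))) ⟩
    g (suc n) 0 + 0# + (Σ≤ n up + Σ≤ n (λ k → (n C suc k) × g (n ∸ k) (suc k)))
      -- The isolated term at `k = 0` is the first term of the sum of `stay`, whose other terms are
      -- the second half of Pascal's rule.
      ≈⟨ x∙yz≈y∙xz _ _ _ ⟩
    Σ≤ n up + Σ≤ (suc n) stay
      ≈⟨ +-congˡ (Σ≤-last n stay) ⟩
    Σ≤ n up + (Σ≤ n stay + stay (suc n))
      -- The surplus last term has coefficient `n C suc n`, which is zero.
      ≈⟨ +-congˡ (trans (+-congˡ (×-congˡ (k>n⇒nCk≡0 (ℕ.n<1+n n)))) (+-identityʳ _)) ⟩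
    Σ≤ n up + Σ≤ n stay
      ≈⟨ Σ≤-+ n up stay ⟨
    Σ≤ n (λ k → up k + stay k)
      -- Truncated subtraction: `suc n ∸ k` is `suc (n ∸ k)` because `k ≤ n`.
      ≈⟨ Σ≤-cong n (λ k k≤n → trans
           (+-congˡ (×-congʳ (n C k) (reflexive (≡.cong (λ i → g i k) (ℕ.+-∸-assoc 1 k≤n)))))
           (sym (×-distrib-+ (g (n ∸ k) (suc k)) (g (suc (n ∸ k)) k) (n C k)))) ⟩
    Σ≤ n (λ k → (n C k) × (g (n ∸ k) (suc k) + g (suc (n ∸ k)) k)) ∎
    where
    up stay : ℕ → A
    up   k = (n C k) × g (n ∸ k) (suc k)
    stay k = (n C k) × g (suc n ∸ k) k

  -- Intertwining relations

  -- For `x = y` this is commutation; in general it lets `x` pass `w` at the price of becoming `y`.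
  -- For fixed `w` the pairs `x`, `y` are closed under the ring operations, so a shift rule for one
  -- element extends to its falling factorials.
  Intertwines : A → A → A → Set ℓ
  Intertwines w x y = x * w ≈ w * y

  Central : A → Set (c ⊔ ℓ)
  Central z = ∀ w → Intertwines w z z

  intertwines-1 : ∀ {w} → Intertwines w 1# 1#
  intertwines-1 = trans (*-identityˡ _) (sym (*-identityʳ _))

  intertwines-+ : ∀ {w x x′ y y′} → Intertwines w x y → Intertwines w x′ y′ →
    Intertwines w (x + x′) (y + y′)
  intertwines-+ p q = trans (distribʳ _ _ _) (trans (+-cong p q) (sym (distribˡ _ _ _)))

  intertwines-* : ∀ {w x x′ y y′} → Intertwines w x y → Intertwines w x′ y′ →
    Intertwines w (x * x′) (y * y′)
  intertwines-* {w} {x} {x′} {y} {y′} p q = begin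
    x * x′ * w    ≈⟨ *-assoc _ _ _ ⟩
    x * (x′ * w)  ≈⟨ *-congˡ q ⟩
    x * (w * y′)  ≈⟨ *-assoc _ _ _ ⟨
    x * w * y′    ≈⟨ *-congʳ p ⟩
    w * y * y′    ≈⟨ *-assoc _ _ _ ⟩
    w * (y * y′)  ∎

  intertwines-neg : ∀ {w x y} → Intertwines w x y → Intertwines w (- x) (- y)
  intertwines-neg p =
    trans (sym (-‿distribˡ-* _ _)) (trans (-‿cong p) (-‿distribʳ-* _ _))

  intertwines-× : ∀ n {w x y} → Intertwines w x y → Intertwines w (n × x) (n × y)
  intertwines-× n p =
    trans (×-assoc-* n _ _) (trans (×-congʳ n p) (sym (×-comm-* n _ _)))

  intertwines-∘ : ∀ {v w x y z} → Intertwines v x y → Intertwines w y z →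
    Intertwines (v * w) x z
  intertwines-∘ {v} {w} {x} {y} {z} p q = begin
    x * (v * w)  ≈⟨ *-assoc _ _ _ ⟨
    x * v * w    ≈⟨ *-congʳ p ⟩
    v * y * w    ≈⟨ *-assoc _ _ _ ⟩
    v * (y * w)  ≈⟨ *-congˡ q ⟩
    v * (w * z)  ≈⟨ *-assoc _ _ _ ⟨
    v * w * z    ∎

  intertwines-^ : ∀ {w x} → Intertwines w x x → ∀ j → Intertwines (w ^ j) x x
  intertwines-^ p zero    = sym intertwines-1
  intertwines-^ p (suc j) = intertwines-∘ p (intertwines-^ p j)

  -- Integer multiples of `1#` commute with everything, so the power of the product separates. This
  -- turns `(m a⁺)^j` into the `m^j (a⁺)^j` of the operator identity.
  ×-^ : ∀ m x j → (m × x) ^ j ≈ (m × 1#) ^ j * x ^ j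
  ×-^ m x zero    = sym (*-identityˡ 1#)
  ×-^ m x (suc j) = begin
    (m × x) * (m × x) ^ j
      ≈⟨ *-cong (trans (×-congʳ m (sym (*-identityˡ x))) (sym (×-assoc-* m 1# x))) (×-^ m x j) ⟩
    (m × 1#) * x * ((m × 1#) ^ j * x ^ j)
      ≈⟨ trans (*-assoc _ _ _) (*-congˡ (sym (*-assoc _ _ _))) ⟩
    (m × 1#) * (x * (m × 1#) ^ j * x ^ j)
      ≈⟨ *-congˡ (*-congʳ (intertwines-^ (sym (intertwines-× m intertwines-1)) j)) ⟩
    (m × 1#) * ((m × 1#) ^ j * x * x ^ j)
      ≈⟨ trans (*-congˡ (*-assoc _ _ _)) (sym (*-assoc _ _ _)) ⟩
    (m × 1#) ^ suc j * x ^ suc j ∎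

  -- Degenerate falling factorials: splitting and Vandermonde convolution

  intertwines-degFalling : ∀ {w x y μ} → Central μ → Intertwines w x y →
    ∀ n → Intertwines w (degFalling x n μ) (degFalling y n μ)
  intertwines-degFalling μ-central p zero    = intertwines-1
  intertwines-degFalling μ-central p (suc n) =
    intertwines-* (intertwines-degFalling μ-central p n)
      (intertwines-+ p (intertwines-neg (intertwines-× n (μ-central _))))

  degFalling-cong : ∀ {x y μ ν} n → x ≈ y → μ ≈ ν → degFalling x n μ ≈ degFalling y n ν
  degFalling-cong zero    x≈y μ≈ν = refl
  degFalling-cong (suc n) x≈y μ≈ν =
    *-cong (degFalling-cong n x≈y μ≈ν) (+-cong x≈y (-‿cong (×-congʳ n μ≈ν)))

  -- The new factor comes on the left; in a noncommutative ring this needs μ central.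
  degFalling-suc : ∀ {x μ} → Central μ → ∀ n →
    degFalling x (suc n) μ ≈ (x - n × μ) * degFalling x n μ
  degFalling-suc {x} {μ} μ-central n = sym (intertwines-+
    (sym (intertwines-degFalling μ-central refl n))
    (intertwines-neg (intertwines-× n (μ-central _))))

  -- New factors are appended on the right, so the last `n` of the `l + n` factors are, in order,
  -- those of `x - l × μ`.
  degFalling-split : ∀ x l n μ →
    degFalling x (l ℕ.+ n) μ ≈ degFalling x l μ * degFalling (x - l × μ) n μ
  degFalling-split x l zero μ =
    trans (reflexive (≡.cong (λ i → degFalling x i μ) (ℕ.+-identityʳ l))) (sym (*-identityʳ _))
  degFalling-split x l (suc n) μ = begin
    degFalling x (l ℕ.+ suc n) μ
      ≡⟨ ≡.cong (λ i → degFalling x i μ) (ℕ.+-suc l n) ⟩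
    degFalling x (l ℕ.+ n) μ * (x - (l ℕ.+ n) × μ)
      ≈⟨ *-cong (degFalling-split x l n μ)
           (trans (+-congˡ (trans (-‿cong (×-homo-+ μ l n)) (sym (-‿+-comm _ _))))
                  (sym (+-assoc _ _ _))) ⟩
    degFalling x l μ * degFalling (x - l × μ) n μ * (x - l × μ - n × μ)
      ≈⟨ *-assoc _ _ _ ⟩
    degFalling x l μ * degFalling (x - l × μ) (suc n) μ ∎

  -- Both factors are built from `x` and the central `μ`, hence they commute. In this order the
  -- factor of length `l` stands next to the vacuum projection, where `dowling-P` applies to it.
  degFalling-split′ : ∀ {x μ} → Central μ → ∀ l n →
    degFalling x (l ℕ.+ n) μ ≈ degFalling (x - l × μ) n μ * degFalling x l μ
  degFalling-split′ {x} {μ} μ-central l n = trans (degFalling-split x l n μ)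
    (intertwines-degFalling μ-central
      (sym (intertwines-degFalling μ-central
        (intertwines-+ refl (intertwines-neg (intertwines-× l (μ-central x)))) n)) l)

  -- Induction on `n`: in the term with index `k` the new factor is the sum of `x - k × μ` and
  -- `s - (n ∸ k) × μ`. The first extends the falling factorial of `x`; the second is central and
  -- moves left to extend that of `s`. `Σ≤-pascal` then regroups the terms.
  degFalling-vandermonde : ∀ {s μ} x → Central s → Central μ → ∀ n →
    degFalling (x + s) n μ ≈
    Σ≤ n (λ k → (n C k) × (degFalling s (n ∸ k) μ * degFalling x k μ))
  degFalling-vandermonde x s-central μ-central zero =
    sym (trans (+-identityʳ _) (trans (+-identityʳ _) (*-identityʳ _)))
  degFalling-vandermonde {s} {μ} x s-central μ-central (suc n) = begin
    degFalling (x + s) n μ * (x + s - n × μ)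
      ≈⟨ *-congʳ (degFalling-vandermonde x s-central μ-central n) ⟩
    Σ≤ n (λ k → (n C k) × g (n ∸ k) k) * (x + s - n × μ)
      ≈⟨ *-distribʳ-Σ≤ n _ (λ k → (n C k) × g (n ∸ k) k) ⟩
    Σ≤ n (λ k → ((n C k) × g (n ∸ k) k) * (x + s - n × μ))
      -- `n` is rewritten as `k + (n ∸ k)`, the form in which `step` distributes it over the two
      -- factors.
      ≈⟨ Σ≤-cong n (λ k k≤n → trans (×-assoc-* (n C k) _ _) (×-congʳ (n C k) (trans
           (*-congˡ (+-congˡ (-‿cong (×-congˡ (≡.sym (ℕ.m+[n∸m]≡n k≤n))))))
           (step (n ∸ k) k)))) ⟩
    Σ≤ n (λ k → (n C k) × (g (n ∸ k) (suc k) + g (suc (n ∸ k)) k))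
      ≈⟨ Σ≤-pascal n g ⟨
    Σ≤ (suc n) (λ k → (suc n C k) × g (suc n ∸ k) k) ∎
    where
    g : ℕ → ℕ → A
    g j k = degFalling s j μ * degFalling x k μ

    step : ∀ j k → g j k * (x + s - (k ℕ.+ j) × μ) ≈ g j (suc k) + g (suc j) k
    step j k = begin
      g j k * (x + s - (k ℕ.+ j) × μ)
        ≈⟨ *-congˡ (trans (+-congˡ (trans (-‿cong (×-homo-+ μ k j)) (sym (-‿+-comm _ _))))
                          (interchange _ _ _ _)) ⟩
      g j k * ((x - k × μ) + (s - j × μ))
        ≈⟨ distribˡ _ _ _ ⟩
      g j k * (x - k × μ) + g j k * (s - j × μ)
        ≈⟨ +-cong (*-assoc _ _ _) (trans (*-assoc _ _ _) (*-congˡ (sym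
             (intertwines-+ (s-central _) (intertwines-neg (intertwines-× j (μ-central _))))))) ⟩
      g j (suc k) + degFalling s j μ * ((s - j × μ) * degFalling x k μ)
        ≈⟨ +-congˡ (*-assoc _ _ _) ⟨
      g j (suc k) + g (suc j) k ∎

-- The right-hand side of the polynomial identity

module Convolution {c ℓ} (R : CommutativeRing c ℓ)
  (m : ℕ) (μ : CommutativeRing.Carrier R) (W : ℕ → ℕ → CommutativeRing.Carrier R)
  (n l : ℕ) where

  open CommutativeRing R
  open RingNotation rawRing using (_×_; degFalling)
  open Polynomial rawRing
  open Whitney rawRing using (dowling)
  private
    module P  = RawRing polyRawRing
    module PN = RingNotation polyRawRing

  shift : ℕ → Carrier
  shift j = ((m ℕ.* j) × 1#) - (l × μ)

  falling : ℕ → ℕ → Carrier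
  falling j k = degFalling (shift j) (n ∸ k) μ

  summand : ℕ → ℕ → Poly
  summand j k = (n C k) PN.×
    (const (W l j) P.* (X PN.^ j) P.* const (falling j k) P.* dowling W k)

  -- Agrees by definition with the right-hand side of `PolynomialIdentity`.
  convolution : Poly
  convolution = PN.Σ≤ l (λ j → PN.Σ≤ n (summand j))

-- Evaluation of polynomials at an element of a boson algebra

module Evaluation {c ℓ b ℓb} {R : CommutativeRing c ℓ} (𝓐 : BosonAlgebra R b ℓb)
  (y : BosonAlgebra.Carrier 𝓐) where

  open BosonAlgebra 𝓐
  open RingLemmas ring
  private
    module R  = CommutativeRing R
    module AN = RingNotation rawRing
    module ι  = RingMorphisms.IsRingHomomorphism ι-isRingHomomorphism
  open Polynomial R.rawRing
  open Whitney R.rawRing using (dowling)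
  private
    module P  = RawRing polyRawRing
    module PN = RingNotation polyRawRing
  open RingMorphisms polyRawRing rawRing using (IsRingHomomorphism)
  open RingProperties ring using (-0#≈0#; -‿distribʳ-*; -‿+-comm)
  open SemiringMult semiring using (×-congʳ)
  open CommutativeSemigroupProperties +-commutativeSemigroup using (interchange)
  open SetoidReasoning setoid

  ⟦_⟧ : Poly → Carrier
  ⟦ p ⟧ = eval p y

  -- Trailing zeros are allowed, so a polynomial equal to `[]` may be a nonempty list. `eval-cong`
  -- meets this case when the two lists differ in length.
  eval-zero : ∀ p → (∀ i → coeff p i R.≈ R.0#) → ⟦ p ⟧ ≈ 0#
  eval-zero []      _   = refl
  eval-zero (r ∷ p) p≈0 = trans
    (+-cong (trans (ι.⟦⟧-cong (p≈0 0)) ι.0#-homo)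
            (trans (*-congˡ (eval-zero p (p≈0 ∘ suc))) (zeroʳ y)))
    (+-identityˡ 0#)

  eval-cong : ∀ {p q} → p ≈ₚ q → ⟦ p ⟧ ≈ ⟦ q ⟧
  eval-cong {[]}    {q}     p≈q = sym (eval-zero q (λ i → R.sym (p≈q i)))
  eval-cong {r ∷ p} {[]}    p≈q = eval-zero (r ∷ p) p≈q
  eval-cong {r ∷ p} {s ∷ q} p≈q =
    +-cong (ι.⟦⟧-cong (p≈q 0)) (*-congˡ (eval-cong {p} {q} (p≈q ∘ suc)))

  eval-+ : ∀ p q → ⟦ p +ₚ q ⟧ ≈ ⟦ p ⟧ + ⟦ q ⟧
  eval-+ []      q       = sym (+-identityˡ _)
  eval-+ (r ∷ p) []      = sym (+-identityʳ _)
  eval-+ (r ∷ p) (s ∷ q) = trans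
    (+-cong (ι.+-homo r s) (trans (*-congˡ (eval-+ p q)) (distribˡ y _ _)))
    (interchange _ _ _ _)

  -- Centrality of `ι r` is what lets it pass `y`; through this lemma evaluation is multiplicative
  -- although the algebra is noncommutative.
  eval-scale : ∀ r q → ⟦ map (r R.*_) q ⟧ ≈ ι r * ⟦ q ⟧
  eval-scale r []      = sym (zeroʳ _)
  eval-scale r (s ∷ q) = begin
    ι (r R.* s) + y * ⟦ map (r R.*_) q ⟧  ≈⟨ +-cong (ι.*-homo r s) (*-congˡ (eval-scale r q)) ⟩
    ι r * ι s + y * (ι r * ⟦ q ⟧)         ≈⟨ +-congˡ (*-assoc _ _ _) ⟨
    ι r * ι s + y * ι r * ⟦ q ⟧           ≈⟨ +-congˡ (*-congʳ (ι-central r y)) ⟨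
    ι r * ι s + ι r * y * ⟦ q ⟧           ≈⟨ +-congˡ (*-assoc _ _ _) ⟩
    ι r * ι s + ι r * (y * ⟦ q ⟧)         ≈⟨ distribˡ _ _ _ ⟨
    ι r * (ι s + y * ⟦ q ⟧)               ∎

  eval-* : ∀ p q → ⟦ p *ₚ q ⟧ ≈ ⟦ p ⟧ * ⟦ q ⟧
  eval-* []      q = sym (zeroˡ _)
  eval-* (r ∷ p) q = begin
    ⟦ map (r R.*_) q +ₚ (R.0# ∷ (p *ₚ q)) ⟧    ≈⟨ eval-+ (map (r R.*_) q) _ ⟩
    ⟦ map (r R.*_) q ⟧ + (ι R.0# + y * ⟦ p *ₚ q ⟧)
      ≈⟨ +-cong (eval-scale r q) (trans (+-congʳ ι.0#-homo) (+-identityˡ _)) ⟩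
    ι r * ⟦ q ⟧ + y * ⟦ p *ₚ q ⟧               ≈⟨ +-congˡ (*-congˡ (eval-* p q)) ⟩
    ι r * ⟦ q ⟧ + y * (⟦ p ⟧ * ⟦ q ⟧)          ≈⟨ +-congˡ (*-assoc _ _ _) ⟨
    ι r * ⟦ q ⟧ + y * ⟦ p ⟧ * ⟦ q ⟧            ≈⟨ distribʳ _ _ _ ⟨
    (ι r + y * ⟦ p ⟧) * ⟦ q ⟧                  ∎

  eval-neg : ∀ p → ⟦ map R.-_ p ⟧ ≈ - ⟦ p ⟧
  eval-neg []      = sym -0#≈0#
  eval-neg (r ∷ p) = trans
    (+-cong (ι.-‿homo r) (trans (*-congˡ (eval-neg p)) (sym (-‿distribʳ-* _ _))))
    (-‿+-comm _ _)

  eval-const : ∀ r → ⟦ const r ⟧ ≈ ι r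
  eval-const r = trans (+-congˡ (zeroʳ y)) (+-identityʳ _)

  eval-X : ⟦ X ⟧ ≈ y
  eval-X = trans (+-cong ι.0#-homo (trans (*-congˡ (trans (eval-const R.1#) ι.1#-homo)) (*-identityʳ y)))
    (+-identityˡ y)

  eval-isRingHomomorphism : IsRingHomomorphism ⟦_⟧
  eval-isRingHomomorphism = record
    { isSemiringHomomorphism = record
      { isNearSemiringHomomorphism = record
        { +-isMonoidHomomorphism = record
          { isMagmaHomomorphism = record
            { isRelHomomorphism = record { cong = λ {p} {q} → eval-cong {p} {q} }
            ; homo              = eval-+
            }
          ; ε-homo = refl
          }
        ; *-homo = eval-*
        }
      ; 1#-homo = trans (eval-const R.1#) ι.1#-homo
      }
    ; -‿homo = eval-neg
    }

  open HomomorphismProperties polyRawRing ring eval-isRingHomomorphism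

  eval-X^ : ∀ j → ⟦ X PN.^ j ⟧ ≈ y AN.^ j
  eval-X^ j = trans (^-homo X j) (^-cong j eval-X)
    where
    ^-cong : ∀ {x x′} n → x ≈ x′ → x AN.^ n ≈ x′ AN.^ n
    ^-cong zero    x≈x′ = refl
    ^-cong (suc n) x≈x′ = *-cong x≈x′ (^-cong n x≈x′)

  eval-term : ∀ r j → ⟦ const r P.* (X PN.^ j) ⟧ ≈ ι r * y AN.^ j
  eval-term r j = trans (eval-* (const r) (X PN.^ j)) (*-cong (eval-const r) (eval-X^ j))

  eval-dowling : ∀ W n → ⟦ dowling W n ⟧ ≈ AN.Σ≤ n (λ k → ι (W n k) * y AN.^ k)
  eval-dowling W n = trans (Σ≤-homo n (λ k → const (W n k) P.* (X PN.^ k)))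
    (Σ≤-cong n (λ k _ → eval-term (W n k) k))

  eval-degFalling : ∀ p n r → ⟦ PN.degFalling p n (const r) ⟧ ≈ AN.degFalling ⟦ p ⟧ n (ι r)
  eval-degFalling p n r = trans (degFalling-homo p n (const r)) (degFalling-cong n refl (eval-const r))

  module _ (m : ℕ) (μ : R.Carrier) (W : ℕ → ℕ → R.Carrier) (n l : ℕ) where

    open Convolution R m μ W n l

    eval-summand : ∀ j k → ⟦ summand j k ⟧ ≈
      (n C k) AN.× (ι (W l j) * y AN.^ j * ι (falling j k) * ⟦ dowling W k ⟧)
    eval-summand j k = trans (×-homo (n C k) p) (×-congʳ (n C k)
      (trans (eval-* (const (W l j) P.* (X PN.^ j) P.* const (falling j k)) (dowling W k))
        (*-congʳ (trans (eval-* (const (W l j) P.* (X PN.^ j)) (const (falling j k)))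
          (*-cong (eval-term (W l j) j) (eval-const (falling j k)))))))
      where
      p : Poly
      p = const (W l j) P.* (X PN.^ j) P.* const (falling j k) P.* dowling W k

    eval-convolution : ⟦ convolution ⟧ ≈ AN.Σ≤ l (λ j → AN.Σ≤ n (λ k →
      (n C k) AN.× (ι (W l j) * y AN.^ j * ι (falling j k) * ⟦ dowling W k ⟧)))
    eval-convolution = trans
      (Σ≤-homo l (λ j → PN.Σ≤ n (summand j)))
      (Σ≤-cong l (λ j _ → trans
        (Σ≤-homo n (summand j))
        (Σ≤-cong n (λ k _ → eval-summand j k))))

-- The identity applied to the vacuum

IsInverseOf : ∀ {c ℓ} (R : CommutativeRing c ℓ) → CommutativeRing.Carrier R → ℕ → Set ℓ
IsInverseOf R r m = (m × 1#) * r ≈ 1#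
  where
  open CommutativeRing R
  open RingNotation rawRing using (_×_)

module VacuumProjection {c ℓ b ℓb} {R : CommutativeRing c ℓ} (𝓐 : BosonAlgebra R b ℓb)
  (P : BosonAlgebra.Carrier 𝓐)
  (aP≈0 : BosonAlgebra._≈_ 𝓐 (BosonAlgebra._*_ 𝓐 (BosonAlgebra.a 𝓐) P) (BosonAlgebra.0# 𝓐))
  (m : ℕ) (m⁻¹ : CommutativeRing.Carrier R) (m*m⁻¹≈1 : IsInverseOf R m⁻¹ m)
  (μ : CommutativeRing.Carrier R) (W : ℕ → ℕ → CommutativeRing.Carrier R)
  (isWhitney : Whitney.IsWhitney (CommutativeRing.rawRing R) m μ W) where

  open BosonAlgebra 𝓐
  open RingLemmas ring
  open RingNotation rawRing
  open Evaluation 𝓐 using (eval-cong; eval-*; eval-+; eval-const; eval-X; eval-dowling;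
    eval-degFalling; eval-isRingHomomorphism; eval-convolution)
  open SemiringMult semiring
    using (×-congʳ; ×-comm-*; ×-assoc-*; ×-assocˡ)
  open CommutativeMonoidMult +-commutativeMonoid using (×-distrib-+)
  open CommutativeSemigroupProperties +-commutativeSemigroup using (xy∙z≈xz∙y)
  open SetoidReasoning setoid
  private
    module R  = CommutativeRing R
    module ι  = RingMorphisms.IsRingHomomorphism ι-isRingHomomorphism
    module ι′ = HomomorphismProperties R.rawRing ring ι-isRingHomomorphism
    module PN = RingNotation (Polynomial.polyRawRing R.rawRing)
    module RN = RingNotation R.rawRing
  open Polynomial R.rawRing
  open Whitney R.rawRing using (dowling)

  -- With `a⁺` as multiplication by x and `a` as d/dx, `U` is formally the Euler operator x d/dx
  -- conjugated by exp(x/m).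
  U T : Carrier
  U = ι m⁻¹ * a⁺ + a⁺ * a
  T = m × U + 1#

  a-a⁺ : a * a⁺ ≈ a⁺ * a + 1#
  a-a⁺ = begin
    a * a⁺                          ≈⟨ +-identityʳ _ ⟨
    a * a⁺ + 0#                     ≈⟨ +-congˡ (-‿inverseˡ _) ⟨
    a * a⁺ + (- (a⁺ * a) + a⁺ * a)  ≈⟨ +-assoc _ _ _ ⟨
    a * a⁺ - a⁺ * a + a⁺ * a        ≈⟨ +-congʳ commutation ⟩
    1# + a⁺ * a                     ≈⟨ +-comm _ _ ⟩
    a⁺ * a + 1#                     ∎

  -- The summand `ι m⁻¹ * a⁺` commutes with `a⁺`, and the number operator `a⁺ * a` gains one by the
  -- commutation relation.
  U-a⁺ : Intertwines a⁺ U (U + 1#)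
  U-a⁺ = trans
    (intertwines-+ (intertwines-* (ι-central m⁻¹ a⁺) refl) (trans (*-assoc _ _ _) (*-congˡ a-a⁺)))
    (*-congˡ (sym (+-assoc _ _ _)))

  U-a⁺^ : ∀ j → Intertwines (a⁺ ^ j) U (U + j × 1#)
  U-a⁺^ zero    = trans (*-identityʳ _) (sym (trans (*-identityˡ _) (+-identityʳ _)))
  U-a⁺^ (suc j) = trans
    (intertwines-∘ U-a⁺ (intertwines-+ (U-a⁺^ j) intertwines-1))
    (*-congˡ (trans (+-assoc _ _ _) (+-congˡ (+-comm _ _))))

  1#-central : Central 1#
  1#-central _ = intertwines-1

  U-P : U * P ≈ ι m⁻¹ * a⁺ * P
  U-P = begin
    U * P                            ≈⟨ distribʳ _ _ _ ⟩
    ι m⁻¹ * a⁺ * P + a⁺ * a * P      ≈⟨ +-congˡ (trans (*-assoc _ _ _) (trans (*-congˡ aP≈0) (zeroʳ a⁺))) ⟩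
    ι m⁻¹ * a⁺ * P + 0#              ≈⟨ +-identityʳ _ ⟩
    ι m⁻¹ * a⁺ * P                   ∎

  -- Induction on `k`, with the newest factor `U - k × 1#` placed on the left: moved past `a⁺ ^ k`
  -- it becomes plain `U`, and `U-P` turns that into one more `ι m⁻¹ * a⁺`, whose scalar cancels the
  -- new factor `ι M`.
  U-falling-P : ∀ k → ι ((m RN.× R.1#) RN.^ k) * falling U k * P ≈ a⁺ ^ k * P
  U-falling-P zero    = *-congʳ (trans (*-identityʳ _) ι.1#-homo)
  U-falling-P (suc k) = begin
    ι (M R.* M^k) * falling U (suc k) * P
      ≈⟨ *-congʳ (*-cong (ι.*-homo M M^k) (degFalling-suc 1#-central k)) ⟩
    ι M * ι M^k * ((U - k × 1#) * falling U k) * P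
      ≈⟨ *-congʳ (trans (*-assoc _ _ _) (*-congˡ (trans (sym (*-assoc _ _ _))
           (trans (*-congʳ (ι-central M^k _)) (*-assoc _ _ _))))) ⟩
    ι M * ((U - k × 1#) * (ι M^k * falling U k)) * P
      ≈⟨ trans (*-assoc _ _ _) (*-congˡ (*-assoc _ _ _)) ⟩
    ι M * ((U - k × 1#) * (ι M^k * falling U k * P))
      ≈⟨ *-congˡ (*-congˡ (U-falling-P k)) ⟩
    ι M * ((U - k × 1#) * (a⁺ ^ k * P))
      ≈⟨ *-congˡ (trans (sym (*-assoc _ _ _)) (*-congʳ (trans
           (intertwines-+ (U-a⁺^ k) (intertwines-neg (intertwines-× k intertwines-1)))
           (*-congˡ (trans (+-assoc _ _ _) (trans (+-congˡ (-‿inverseʳ _)) (+-identityʳ _))))))) ⟩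
    ι M * (a⁺ ^ k * U * P)
      ≈⟨ *-congˡ (trans (*-assoc _ _ _) (trans (*-congˡ U-P) (trans (sym (*-assoc _ _ _))
           (*-congʳ (trans (sym (*-assoc _ _ _)) (trans (*-congʳ (sym (ι-central m⁻¹ _))) (*-assoc _ _ _))))))) ⟩
    ι M * (ι m⁻¹ * (a⁺ ^ k * a⁺) * P)
      ≈⟨ trans (sym (*-assoc _ _ _)) (*-congʳ (sym (*-assoc _ _ _))) ⟩
    ι M * ι m⁻¹ * (a⁺ ^ k * a⁺) * P
      ≈⟨ *-congʳ (trans (*-cong (trans (sym (ι.*-homo M m⁻¹)) (trans (ι.⟦⟧-cong m*m⁻¹≈1) ι.1#-homo))
                               (sym (intertwines-^ refl k)))
                        (*-identityˡ _)) ⟩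
    a⁺ ^ suc k * P ∎
    where
    M   = m RN.× R.1#
    M^k = M RN.^ k

  dowling-P : ∀ n → eval (dowling W n) a⁺ * P ≈ degFalling T n (ι μ) * P
  dowling-P n = begin
    eval (dowling W n) a⁺ * P
      ≈⟨ *-congʳ (eval-dowling a⁺ W n) ⟩
    Σ≤ n (λ k → ι (W n k) * a⁺ ^ k) * P
      ≈⟨ *-distribʳ-Σ≤ n P (λ k → ι (W n k) * a⁺ ^ k) ⟩
    Σ≤ n (λ k → ι (W n k) * a⁺ ^ k * P)
      -- In front of `P`, each power of `a⁺` is traded for a scaled falling factorial of `U`.
      ≈⟨ Σ≤-cong n (λ k _ → term k) ⟩
    Σ≤ n (λ k → eval (w k) U * P)
      ≈⟨ *-distribʳ-Σ≤ n P (λ k → eval (w k) U) ⟨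
    Σ≤ n (λ k → eval (w k) U) * P
      ≈⟨ *-congʳ (evalU.Σ≤-homo n w) ⟨
    eval (PN.Σ≤ n w) U * P
      -- The defining identity of the Whitney numbers, read from right to left at the operator `U`.
      ≈⟨ *-congʳ (eval-cong U {PN.degFalling mX+1 n (const μ)} {PN.Σ≤ n w} (isWhitney n)) ⟨
    eval (PN.degFalling mX+1 n (const μ)) U * P
      ≈⟨ *-congʳ (trans (eval-degFalling U mX+1 n μ) (degFalling-cong n eval-mX+1 refl)) ⟩
    degFalling T n (ι μ) * P ∎
    where
    module evalU = HomomorphismProperties polyRawRing ring (eval-isRingHomomorphism U)

    mX+1 : Poly
    mX+1 = (m PN.× X) +ₚ const R.1#

    w : ℕ → Poly
    w k = const (W n k R.* (m RN.× R.1#) RN.^ k) *ₚ PN.falling X k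

    eval-mX+1 : eval mX+1 U ≈ T
    eval-mX+1 = trans (eval-+ U (m PN.× X) (const R.1#))
      (+-cong (trans (evalU.×-homo m X) (×-congʳ m (eval-X U)))
              (trans (eval-const U R.1#) ι.1#-homo))

    eval-falling : ∀ k → eval (PN.falling X k) U ≈ falling U k
    eval-falling k = trans (eval-degFalling U X k R.1#) (degFalling-cong k (eval-X U) ι.1#-homo)

    term : ∀ k → ι (W n k) * a⁺ ^ k * P ≈ eval (w k) U * P
    term k = begin
      ι (W n k) * a⁺ ^ k * P
        ≈⟨ *-assoc _ _ _ ⟩
      ι (W n k) * (a⁺ ^ k * P)
        ≈⟨ *-congˡ (U-falling-P k) ⟨
      ι (W n k) * (ι ((m RN.× R.1#) RN.^ k) * falling U k * P)
        ≈⟨ trans (sym (*-assoc _ _ _)) (*-congʳ (trans (sym (*-assoc _ _ _)) (*-congʳ (sym (ι.*-homo _ _))))) ⟩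
      ι (W n k R.* (m RN.× R.1#) RN.^ k) * falling U k * P
        ≈⟨ *-congʳ (trans (eval-* U (const _) (PN.falling X k)) (*-cong (eval-const U _) (eval-falling k))) ⟨
      eval (w k) U * P ∎

  module _ (n l : ℕ) where

    open Convolution R m μ W n l using (shift; convolution) renaming (falling to coefficient)

    -- Passing `a⁺ ^ j` adds `j` to `U`, hence `m j` to `T`; together with `- l μ` this is the
    -- scalar `shift j`.
    T-shift : ∀ j → Intertwines (a⁺ ^ j) (T - l × ι μ) (T + ι (shift j))
    T-shift j = trans
      (intertwines-+ (intertwines-+ (intertwines-× m (U-a⁺^ j)) intertwines-1)
                     (intertwines-neg (intertwines-× l (ι-central μ _))))
      (*-congˡ (begin
        m × (U + j × 1#) + 1# - l × ι μ
          ≈⟨ +-congʳ (+-congʳ (trans (×-distrib-+ U (j × 1#) m) (+-congˡ (×-assocˡ 1# m j)))) ⟩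
        m × U + (m ℕ.* j) × 1# + 1# - l × ι μ
          ≈⟨ +-congʳ (xy∙z≈xz∙y _ _ _) ⟩
        T + (m ℕ.* j) × 1# - l × ι μ
          ≈⟨ +-assoc _ _ _ ⟩
        T + ((m ℕ.* j) × 1# - l × ι μ)
          -- The increments are gathered under one `ι`, so that the total is visibly central, as the
          -- Vandermonde convolution requires.
          ≈⟨ +-congˡ (+-cong (trans (ι′.×-homo (m ℕ.* j) R.1#) (×-congʳ (m ℕ.* j) ι.1#-homo))
                             (trans (ι.-‿homo _) (-‿cong (ι′.×-homo l μ)))) ⟨
        T + (ι ((m ℕ.* j) RN.× R.1#) + ι (R.- (l RN.× μ)))
          ≈⟨ +-congˡ (ι.+-homo _ _) ⟨
        T + ι (shift j) ∎))

    term : ℕ → ℕ → Carrier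
    term j k = ι (W l j) * a⁺ ^ j * ι (coefficient j k) * eval (dowling W k) a⁺

    -- Once the operator has passed `a⁺ ^ j`, the Vandermonde convolution leaves a falling factorial
    -- of `T` next to `P` in each term, and `dowling-P` read backwards makes it a Dowling polynomial
    -- in `a⁺`.
    shifted-term-P : ∀ j →
      degFalling (T - l × ι μ) n (ι μ) * (ι (W l j) * a⁺ ^ j) * P ≈ Σ≤ n (λ k → (n C k) × term j k) * P
    shifted-term-P j = begin
      degFalling (T - l × ι μ) n (ι μ) * w * P
        ≈⟨ *-congʳ (intertwines-degFalling (ι-central μ)
             (intertwines-∘ (sym (ι-central (W l j) _)) (T-shift j)) n) ⟩
      w * degFalling (T + ι (shift j)) n (ι μ) * P
        ≈⟨ trans (*-congʳ (trans (*-congˡ (degFalling-vandermonde T (ι-central _) (ι-central μ) n))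
                                 (*-distribˡ-Σ≤ n w v)))
                 (*-distribʳ-Σ≤ n P (λ k → w * v k)) ⟩
      Σ≤ n (λ k → w * v k * P)
        ≈⟨ Σ≤-cong n (λ k _ → summand k) ⟩
      Σ≤ n (λ k → (n C k) × term j k * P)
        ≈⟨ *-distribʳ-Σ≤ n P (λ k → (n C k) × term j k) ⟨
      Σ≤ n (λ k → (n C k) × term j k) * P ∎
      where
      w : Carrier
      w = ι (W l j) * a⁺ ^ j

      d v : ℕ → Carrier
      d k = degFalling (ι (shift j)) (n ∸ k) (ι μ)
      v k = (n C k) × (d k * degFalling T k (ι μ))

      summand : ∀ k → w * v k * P ≈ (n C k) × term j k * P
      summand k = begin
        w * v k * P
          ≈⟨ trans (*-congʳ (×-comm-* (n C k) _ _)) (×-assoc-* (n C k) _ _) ⟩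
        (n C k) × (w * (d k * degFalling T k (ι μ)) * P)
          ≈⟨ ×-congʳ (n C k) (begin
               w * (d k * degFalling T k (ι μ)) * P  ≈⟨ *-congʳ (*-assoc _ _ _) ⟨
               w * d k * degFalling T k (ι μ) * P    ≈⟨ *-assoc _ _ _ ⟩
               w * d k * (degFalling T k (ι μ) * P)  ≈⟨ *-cong (*-congˡ (ι′.degFalling-homo _ (n ∸ k) μ)) (dowling-P k) ⟨
               w * ι (coefficient j k) * (eval (dowling W k) a⁺ * P) ≈⟨ *-assoc _ _ _ ⟨
               term j k * P ∎) ⟩
        (n C k) × (term j k * P)
          ≈⟨ ×-assoc-* (n C k) _ _ ⟨
        (n C k) × term j k * P ∎

    dowling-convolution-P :
      eval (dowling W (n ℕ.+ l)) a⁺ * P ≈ eval convolution a⁺ * P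
    dowling-convolution-P = begin
      eval (dowling W (n ℕ.+ l)) a⁺ * P
        ≈⟨ dowling-P (n ℕ.+ l) ⟩
      degFalling T (n ℕ.+ l) (ι μ) * P
        ≈⟨ *-congʳ (trans (reflexive (≡.cong (λ i → degFalling T i (ι μ)) (ℕ.+-comm n l)))
                          (degFalling-split′ (ι-central μ) l n)) ⟩
      T′ * degFalling T l (ι μ) * P
        -- The `l` factors next to `P` become a polynomial in `a⁺`, past whose powers `T′` can then
        -- be moved.
        ≈⟨ trans (*-assoc _ _ _) (*-congˡ (sym (dowling-P l))) ⟩
      T′ * (eval (dowling W l) a⁺ * P)
        ≈⟨ trans (*-congˡ (*-congʳ (eval-dowling a⁺ W l))) (sym (*-assoc _ _ _)) ⟩
      T′ * Σ≤ l (λ j → ι (W l j) * a⁺ ^ j) * P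
        ≈⟨ *-congʳ (*-distribˡ-Σ≤ l T′ (λ j → ι (W l j) * a⁺ ^ j)) ⟩
      Σ≤ l (λ j → T′ * (ι (W l j) * a⁺ ^ j)) * P
        ≈⟨ *-distribʳ-Σ≤ l P (λ j → T′ * (ι (W l j) * a⁺ ^ j)) ⟩
      Σ≤ l (λ j → T′ * (ι (W l j) * a⁺ ^ j) * P)
        ≈⟨ Σ≤-cong l (λ j _ → shifted-term-P j) ⟩
      Σ≤ l (λ j → Σ≤ n (λ k → (n C k) × term j k) * P)
        ≈⟨ *-distribʳ-Σ≤ l P (λ j → Σ≤ n (λ k → (n C k) × term j k)) ⟨
      Σ≤ l (λ j → Σ≤ n (λ k → (n C k) × term j k)) * P
        ≈⟨ *-congʳ (eval-convolution a⁺ m μ W n l) ⟨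
      eval convolution a⁺ * P ∎
      where
      T′ : Carrier
      T′ = degFalling (T - l × ι μ) n (ι μ)

-- The Fock space representation

-- The algebra acts on formal power series f = Σ fᵢ xⁱ, with a = d/dx and a⁺ = x.
module FockSpace {c ℓ} (R : CommutativeRing c ℓ) where

  open CommutativeRing R renaming (Carrier to K) hiding (zero)
  open RingNotation rawRing using (_×_)
  open RingProperties ring using (-‿distribʳ-*; -‿+-comm; -0#≈0#)
  open SemiringMult semiring using (×-congʳ; ×-comm-*; ×-homo-1)
  open CommutativeMonoidMult +-commutativeMonoid using (×-distrib-+)
  open CommutativeSemigroupProperties +-commutativeSemigroup using (interchange)
  open CommutativeSemigroupProperties *-commutativeSemigroup using (x∙yz≈y∙xz)
  open SetoidReasoning setoid
  open Polynomial rawRing using (coeff; _≈ₚ_)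

  Series : Set c
  Series = ℕ → K

  infix 4 _≋_
  _≋_ : Series → Series → Set ℓ
  f ≋ g = ∀ i → f i ≈ g i

  -- Each law feeds one axiom of the algebra: congruence makes composition respect equality,
  -- additivity gives left distributivity, and homogeneity makes the scalars central.
  record LinearOperator : Set (c ⊔ ℓ) where
    infixr 9 _·_
    field
      _·_      : Series → Series
      ·-cong   : ∀ {f g} → f ≋ g → _·_ f ≋ _·_ g
      ·-+-homo : ∀ f g → _·_ (λ i → f i + g i) ≋ (λ i → _·_ f i + _·_ g i)
      ·-*-homo : ∀ r f → _·_ (λ i → r * f i) ≋ (λ i → r * _·_ f i)

  open LinearOperator

  operatorRing : Ring (c ⊔ ℓ) (c ⊔ ℓ)
  operatorRing = record
    { Carrier = LinearOperator
    ; _≈_ = λ S T → ∀ f → S · f ≋ T · f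
    ; _+_ = λ S T → record
      { _·_      = λ f i → (S · f) i + (T · f) i
      ; ·-cong   = λ p i → +-cong (·-cong S p i) (·-cong T p i)
      ; ·-+-homo = λ f g i → trans (+-cong (·-+-homo S f g i) (·-+-homo T f g i)) (interchange _ _ _ _)
      ; ·-*-homo = λ r f i → trans (+-cong (·-*-homo S r f i) (·-*-homo T r f i)) (sym (distribˡ _ _ _))
      }
    ; _*_ = λ S T → record
      { _·_      = λ f → S · T · f
      ; ·-cong   = λ p → ·-cong S (·-cong T p)
      ; ·-+-homo = λ f g i → trans (·-cong S (·-+-homo T f g) i) (·-+-homo S _ _ i)
      ; ·-*-homo = λ r f i → trans (·-cong S (·-*-homo T r f) i) (·-*-homo S r _ i)
      }
    ; -_ = λ S → record
      { _·_      = λ f i → - (S · f) i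
      ; ·-cong   = λ p i → -‿cong (·-cong S p i)
      ; ·-+-homo = λ f g i → trans (-‿cong (·-+-homo S f g i)) (sym (-‿+-comm _ _))
      ; ·-*-homo = λ r f i → trans (-‿cong (·-*-homo S r f i)) (-‿distribʳ-* _ _)
      }
    ; 0# = record
      { _·_      = λ _ _ → 0#
      ; ·-cong   = λ _ _ → refl
      ; ·-+-homo = λ _ _ _ → sym (+-identityʳ 0#)
      ; ·-*-homo = λ r _ _ → sym (zeroʳ r)
      }
    ; 1# = record
      { _·_      = λ f → f
      ; ·-cong   = λ p → p
      ; ·-+-homo = λ _ _ _ → refl
      ; ·-*-homo = λ _ _ _ → refl
      }
    ; isRing = record
      { +-isAbelianGroup = record
        { isGroup = record
          { isMonoid = record
            { isSemigroup = record
              { isMagma = record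
                { isEquivalence = record
                  { refl  = λ _ _ → refl
                  ; sym   = λ p f i → sym (p f i)
                  ; trans = λ p q f i → trans (p f i) (q f i)
                  }
                ; ∙-cong = λ p q f i → +-cong (p f i) (q f i)
                }
              ; assoc = λ _ _ _ _ _ → +-assoc _ _ _
              }
            ; identity = (λ _ _ _ → +-identityˡ _) , (λ _ _ _ → +-identityʳ _)
            }
          ; inverse = (λ _ _ _ → -‿inverseˡ _) , (λ _ _ _ → -‿inverseʳ _)
          ; ⁻¹-cong = λ p f i → -‿cong (p f i)
          }
        ; comm = λ _ _ _ _ → +-comm _ _
        }
      ; *-cong     = λ {S} p q f i → trans (·-cong S (q f) i) (p _ i)
      ; *-assoc    = λ _ _ _ _ _ → refl
      ; *-identity = (λ _ _ _ → refl) , (λ _ _ _ → refl)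
      ; distrib    = (λ S _ _ _ → ·-+-homo S _ _) , (λ _ _ _ _ _ → refl)
      }
    }

  scalar : K → LinearOperator
  scalar r = record
    { _·_      = λ f i → r * f i
    ; ·-cong   = λ p i → *-congˡ (p i)
    ; ·-+-homo = λ _ _ _ → distribˡ _ _ _
    ; ·-*-homo = λ _ _ _ → x∙yz≈y∙xz _ _ _
    }

  annihilation : LinearOperator
  annihilation = record
    { _·_      = λ f i → suc i × f (suc i)
    ; ·-cong   = λ p i → ×-congʳ (suc i) (p (suc i))
    ; ·-+-homo = λ _ _ i → ×-distrib-+ _ _ (suc i)
    ; ·-*-homo = λ _ _ i → sym (×-comm-* (suc i) _ _)
    }

  creation : LinearOperator
  creation = record
    { _·_      = λ { f zero → 0# ; f (suc i) → f i }
    ; ·-cong   = λ { p zero → refl ; p (suc i) → p i }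
    ; ·-+-homo = λ { _ _ zero → sym (+-identityʳ 0#) ; _ _ (suc _) → refl }
    ; ·-*-homo = λ { r _ zero → sym (zeroʳ r) ; _ _ (suc _) → refl }
    }

  vacuumProjection : LinearOperator
  vacuumProjection = record
    { _·_      = λ { f zero → f zero ; f (suc _) → 0# }
    ; ·-cong   = λ { p zero → p zero ; p (suc _) → refl }
    ; ·-+-homo = λ { _ _ zero → refl ; _ _ (suc _) → sym (+-identityʳ 0#) }
    ; ·-*-homo = λ { _ _ zero → refl ; r _ (suc _) → sym (zeroʳ r) }
    }

  fockSpace : BosonAlgebra R (c ⊔ ℓ) (c ⊔ ℓ)
  fockSpace = record
    { ring = operatorRing
    ; ι    = scalar
    ; ι-isRingHomomorphism = record
      { isSemiringHomomorphism = record
        { isNearSemiringHomomorphism = record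
          { +-isMonoidHomomorphism = record
            { isMagmaHomomorphism = record
              { isRelHomomorphism = record { cong = λ r≈s _ _ → *-congʳ r≈s }
              ; homo              = λ _ _ _ _ → distribʳ _ _ _
              }
            ; ε-homo = λ _ _ → zeroˡ _
            }
          ; *-homo = λ _ _ _ _ → *-assoc _ _ _
          }
        ; 1#-homo = λ _ _ → *-identityˡ _
        }
      ; -‿homo = λ _ _ _ → sym (RingProperties.-‿distribˡ-* ring _ _)
      }
    ; ι-central   = λ r S f i → sym (·-*-homo S r f i)
    ; a           = annihilation
    ; a⁺          = creation
    ; commutation = λ
      { f zero    → trans (+-cong (×-homo-1 _) -0#≈0#) (+-identityʳ _)
      -- `suc (suc i) × x` unfolds to `x + suc i × x`, so subtracting `suc i × x` leaves `x`.
      ; f (suc i) → trans (+-assoc _ _ _) (trans (+-congˡ (-‿inverseʳ _)) (+-identityʳ _))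
      }
    }

  open BosonAlgebra fockSpace using (eval) renaming (_*_ to _∘ₒ_; _≈_ to _≈ₒ_; 0# to 0ₒ)

  annihilation-vacuum : (annihilation ∘ₒ vacuumProjection) ≈ₒ 0ₒ
  annihilation-vacuum _ i = begin
    -- Zero is written as a product so that the multiple can be moved into one factor and absorbed
    -- by the other.
    suc i × 0#          ≈⟨ ×-congʳ (suc i) (zeroˡ 0#) ⟨
    suc i × (0# * 0#)   ≈⟨ ×-comm-* (suc i) 0# 0# ⟨
    0# * (suc i × 0#)   ≈⟨ zeroˡ _ ⟩
    0#                  ∎

  -- A test vector: `vacuumProjection` sends it to the vacuum, the power series 1.
  one : Series
  one _ = 1#

  -- Horner evaluation at `creation` adds a constant term to a shifted series, which is how a
  -- coefficient list is built.
  eval-vacuum : ∀ p i → ((eval p creation ∘ₒ vacuumProjection) · one) i ≈ coeff p i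
  eval-vacuum []      i       = refl
  eval-vacuum (r ∷ p) zero    = trans (+-identityʳ _) (*-identityʳ r)
  eval-vacuum (r ∷ p) (suc i) = trans (+-cong (zeroʳ r) (eval-vacuum p i)) (+-identityˡ _)

  eval-vacuum-injective : ∀ p q →
    (eval p creation ∘ₒ vacuumProjection) ≈ₒ (eval q creation ∘ₒ vacuumProjection) → p ≈ₚ q
  eval-vacuum-injective p q p≈q i =
    trans (sym (eval-vacuum p i)) (trans (p≈q one i) (eval-vacuum q i))

-- The two forms of the identity

polynomialIdentity : ∀ {c ℓ} (R : CommutativeRing c ℓ) m m⁻¹ → IsInverseOf R m⁻¹ m →
  ∀ μ W → Whitney.IsWhitney (CommutativeRing.rawRing R) m μ W →
  ∀ n l → Identities.PolynomialIdentity R m μ W n l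
polynomialIdentity R m m⁻¹ m*m⁻¹≈1 μ W isWhitney n l =
  eval-vacuum-injective (dowling W (n ℕ.+ l)) (Convolution.convolution R m μ W n l)
    (dowling-convolution-P n l)
  where
  open FockSpace R
  open VacuumProjection fockSpace vacuumProjection annihilation-vacuum
    m m⁻¹ m*m⁻¹≈1 μ W isWhitney
  open Whitney (CommutativeRing.rawRing R) using (dowling)

-- An arbitrary boson algebra may have no nonzero element annihilated by `a`, so the vacuum argument
-- is not repeated there; the polynomial identity is evaluated at `m × a⁺` instead.
operatorIdentity : ∀ {c ℓ b ℓb} (R : CommutativeRing c ℓ) (𝓐 : BosonAlgebra R b ℓb) →
  ∀ m μ W n l → Identities.PolynomialIdentity R m μ W n l →
  Identities.OperatorIdentity R m μ W n l 𝓐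
operatorIdentity R 𝓐 m μ W n l identity = begin
  eval (dowling W (n ℕ.+ l)) y
    ≈⟨ eval-cong {dowling W (n ℕ.+ l)} {convolution} identity ⟩
  eval convolution y
    ≈⟨ eval-convolution m μ W n l ⟩
  Σ≤ l (λ j → Σ≤ n (f j))
    ≈⟨ Σ≤-cong l {λ j → Σ≤ n (f j)} {λ j → Σ≤ n (g j)}
         (λ j _ → Σ≤-cong n {f j} {g j} (λ k _ → ×-congʳ (n C k) (*-congʳ (*-congʳ
           (trans (*-congˡ (×-^ m a⁺ j)) (sym (*-assoc _ _ _))))))) ⟩
  Σ≤ l (λ j → Σ≤ n (g j)) ∎
  where
  open BosonAlgebra 𝓐
  open RingNotation rawRing using (Σ≤; _×_; _^_)
  open RingLemmas ring using (Σ≤-cong; ×-^)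
  open SemiringMult semiring using (×-congʳ)
  open SetoidReasoning setoid
  y : Carrier
  y = m × a⁺
  open Evaluation 𝓐 y using (eval-cong; eval-convolution)
  open Convolution R m μ W n l using (convolution; falling)
  open Whitney (CommutativeRing.rawRing R) using (dowling)

  f g : ℕ → ℕ → Carrier
  f j k = (n C k) × (ι (W l j) * y ^ j * ι (falling j k) * eval (dowling W k) y)
  g j k = (n C k) × (ι (W l j) * (m × 1#) ^ j * a⁺ ^ j * ι (falling j k) * eval (dowling W k) y)

open import Data.Product.Base using (_×_)
open HeytingField using (Carrier; _#_; 0#)

theorem3p1 : ∀ {c ℓ₁ ℓ₂ b ℓb : Level} (F : HeytingField c ℓ₁ ℓ₂) → CharacteristicZero F →
    (m : ℕ) → .{{_ : NonZero m}} →
    (μ : Carrier F) → _#_ F μ (0# F) →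
    (W : ℕ → ℕ → Carrier F) → Whitney.IsWhitney (CommutativeRing.rawRing (fieldRing F)) m μ W →
    (n l : ℕ) →
    Identities.PolynomialIdentity (fieldRing F) m μ W n l
    × ((A : BosonAlgebra (fieldRing F) b ℓb) → Identities.OperatorIdentity (fieldRing F) m μ W n l A)
theorem3p1 F charZero m μ μ#0 W isWhitney n l =
  identity , λ A → operatorIdentity (fieldRing F) A m μ W n l identity
  where
  open CommutativeRing (fieldRing F)
    using (trans; sym; *-congʳ; +-congˡ; +-identityʳ; ring)

  -- Characteristic zero puts `m × 1#` apart from zero, which supplies the inverse in the definition
  -- of `U`.
  m-invertible = HeytingField.#⇒invertible F (charZero m)

  m⁻¹ : Carrier F
  m⁻¹ = proj₁ m-invertible

  m*m⁻¹≈1 : IsInverseOf (fieldRing F) m⁻¹ m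
  -- Apartness from `0#` inverts the difference `m × 1# - 0#`; the subtracted zero is removed here.
  m*m⁻¹≈1 = trans
    (*-congʳ (sym (trans (+-congˡ (RingProperties.-0#≈0# ring)) (+-identityʳ _))))
    (proj₂ (proj₂ m-invertible))

  identity : Identities.PolynomialIdentity (fieldRing F) m μ W n l
  identity = polynomialIdentity (fieldRing F) m m⁻¹ m*m⁻¹≈1 μ W isWhitney n l
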